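{- Let $n\ge 1$ and $A$ be as in the context. A position $P$ of $\mathrm{AGG}(n,A)$ is reachable if and only if the sequence $v_1\le v_2\le\dots\le v_n$ of its cell values, sorted in nondecreasing order with each empty cell counted as value $0$ (so $v_i=0$ exactly when $P$ has at least $i$ empty cells), satisfies $v_i\le \mathrm{Single}(i,A)$ for every $i=1,\dots,n$.
   Context: Let $A$ be a set of positive integers with $1\in A$ (the allowed tile values). For an integer $n\ge 0$, the abstract generalized 2048 game $\mathrm{AGG}(n,A)$ is played on $n$ indistinguishable cells. A position assigns to each cell either nothing (the cell is empty) or a tile carrying a value in $A$. The initial position has all cells empty. A step, which can be performed from any position having at least one empty cell, consists of: (i) placing a new tile of value $1$ into a chosen empty cell; then (ii) optionally choosing any collection of pairwise disjoint sets of nonempty cells such that the sum of the tile values in each chosen set belongs to $A$, and merging each chosen set into a single tile, whose value is that sum, placed in one cell of the set, the other cells of the set becoming empty. The game ends when, after a step, all cells are nonempty (no further step is then possible). A position is reachable if it can be obtained from the initial position by a finite sequence of steps. For $n\ge1$, $\mathrm{Single}(n,A)$ denotes the supremum (possibly $\infty$) of the values $x\in A$ such that the position of $\mathrm{AGG}(n,A)$ with one tile of value $x$ and $n-1$ empty cells is reachable. -}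

module Defs where

open import Axiom.ExcludedMiddle using (ExcludedMiddle)
open import Data.Bool.Base using (if_then_else_)
open import Data.Empty using (⊥-elim)
open import Data.Fin.Base using (Fin)
open import Data.Fin.Subset using (Subset; _∈_; _∉_; _∩_; Empty)
open import Data.List.Base using (List)
import Data.List.Membership.Propositional as List
open import Data.List.Relation.Binary.Permutation.Propositional using (_↭_)
open import Data.List.Relation.Unary.AllPairs using (AllPairs)
import Data.List.Relation.Unary.Sorted.TotalOrder as Sorting
open import Data.Maybe.Base using (Maybe; just; nothing; fromMaybe)
open import Data.Maybe using (Is-just)
import Data.Maybe.Relation.Unary.All as Maybe
open import Data.Nat.Base using (ℕ; zero; suc; _≤_; _<_; s≤s⁻¹)
open import Data.Nat.Properties
  using (≤-totalOrder; ≮⇒≥; ≤∧≢⇒<; <⇒≱)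
open import Data.Product.Base using (∃; _×_; _,_)
open import Data.Vec.Base using (Vec; lookup; replicate; zipWith; sum; map; toList; _[_]≔_)
open import Data.Vec.Relation.Unary.All using (All)
open import Level using (0ℓ)
open import Relation.Binary.Construct.Add.Supremum.NonStrict _≤_ public
  using (_≤⁺_; [_]; _≤⊤⁺)
open import Relation.Binary.Construct.Add.Supremum.Strict _<_ public
  using (_<⁺_; [_]; [_]<⊤⁺)
open import Relation.Binary.Construct.Closure.ReflexiveTransitive using (Star)
open import Relation.Binary.PropositionalEquality.Core using (_≡_; _≢_; refl)
open import Relation.Nullary.Construct.Add.Supremum public using (_⁺; [_]; ⊤⁺)
open import Relation.Nullary.Decidable.Core using (yes; no)
open import Relation.Nullary.Negation.Core using (¬_)
open import Relation.Unary using (Pred)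

-- A cell is `nothing` when empty and `just x` when it carries a tile of value x.
Board : ℕ → Set
Board n = Vec (Maybe ℕ) n

IsPosition : Pred ℕ 0ℓ → ∀ {n} → Board n → Set
IsPosition A = All (Maybe.All A)

emptyBoard : ∀ n → Board n
emptyBoard n = replicate n nothing

value : Maybe ℕ → ℕ
value = fromMaybe 0

-- Cells are indistinguishable, so boards that differ by a permutation of the
-- cells represent the same position.
_≈_ : ∀ {n} → Board n → Board n → Set
P ≈ Q = toList P ↭ toList Q

record Block (n : ℕ) : Set where
  field
    cells    : Subset n
    target   : Fin n
    target∈  : target ∈ cells

open Block public

total : ∀ {n} → Board n → Subset n → ℕ
total P S = sum (zipWith (λ inside? c → if inside? then value c else 0) S P)

-- Q arises from P by merging some (possibly empty) collection of pairwise
-- disjoint sets of nonempty cells.  The last three fields determine Q.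
record Merge (A : Pred ℕ 0ℓ) {n : ℕ} (P Q : Board n) : Set where
  field
    blocks    : List (Block n)
    disjoint  : AllPairs (λ b c → Empty (cells b ∩ cells c)) blocks
    nonempty  : ∀ {b} → b List.∈ blocks → ∀ {j} → j ∈ cells b → Is-just (lookup P j)
    allowed   : ∀ {b} → b List.∈ blocks → A (total P (cells b))
    merged    : ∀ {b} → b List.∈ blocks →
                lookup Q (target b) ≡ just (total P (cells b))
    vacated   : ∀ {b} → b List.∈ blocks → ∀ {j} → j ∈ cells b → j ≢ target b →
                lookup Q j ≡ nothing
    untouched : ∀ {j} → (∀ {b} → b List.∈ blocks → j ∉ cells b) →
                lookup Q j ≡ lookup P j

Step : Pred ℕ 0ℓ → ∀ {n} → Board n → Board n → Set
Step A P Q = ∃ λ c → lookup P c ≡ nothing × Merge A (P [ c ]≔ just 1) Q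

-- Steps commute with permutations of the cells, so it suffices to identify
-- boards up to _≈_ at the end of a play.
Reachable : Pred ℕ 0ℓ → ∀ {n} → Board n → Set
Reachable A {n} P = ∃ λ Q → Star (Step A) (emptyBoard n) Q × Q ≈ P

SingleValue : ℕ → Pred ℕ 0ℓ → Pred ℕ 0ℓ
SingleValue n A x = A x × ∃ λ (c : Fin n) → Reachable A (emptyBoard n [ c ]≔ just x)

-- ℕ ⁺ is ℕ ∪ {∞}, with ⊤⁺ as ∞.  Approximation from below is the constructive
-- form of leastness; `supremum-least` and `supremum-exists` relate it to the
-- classical notion.
record IsSupremum (S : Pred ℕ 0ℓ) (s : ℕ ⁺) : Set where
  field
    upper  : ∀ {x} → S x → [ x ] ≤⁺ s
    approx : ∀ k → [ k ] <⁺ s → ∃ λ x → S x × k < x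

supremum-least : ∀ {S s} → IsSupremum S s →
                 ∀ t → (∀ {x} → S x → [ x ] ≤⁺ t) → s ≤⁺ t
supremum-least {s = s} _ ⊤⁺ _ = s ≤⊤⁺
supremum-least {s = ⊤⁺} sup [ m ] ub with IsSupremum.approx sup m [ m ]<⊤⁺
... | x , x∈S , m<x with ub x∈S
... | [ x≤m ] = ⊥-elim (<⇒≱ m<x x≤m)
supremum-least {S} {s = [ k ]} sup [ m ] ub = [ ≮⇒≥ k≯m ]
  where
  k≯m : ¬ (m < k)
  k≯m m<k with IsSupremum.approx sup m [ m<k ]
  ... | x , x∈S , m<x with ub x∈S
  ... | [ x≤m ] = <⇒≱ m<x x≤m

supremum-exists : ExcludedMiddle 0ℓ → ∀ S → ∃ (IsSupremum S)
supremum-exists em S with em {∃ λ b → ∀ {x} → S x → x ≤ b}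
... | yes (b , ub) = bounded b ub
  where
  bounded : ∀ b → (∀ {x} → S x → x ≤ b) → ∃ (IsSupremum S)
  bounded zero ub = [ 0 ] , record
    { upper = λ x∈S → [ ub x∈S ] ; approx = λ { _ [ () ] } }
  bounded (suc b) ub with em {S (suc b)}
  ... | yes b∈S = [ suc b ] , record
    { upper = λ x∈S → [ ub x∈S ] ; approx = λ { _ [ k<b ] → suc b , b∈S , k<b } }
  ... | no  b∉S = bounded b
    λ x∈S → s≤s⁻¹ (≤∧≢⇒< (ub x∈S) λ { refl → b∉S x∈S })
... | no unbounded = ⊤⁺ , record { upper = λ _ → _ ≤⊤⁺ ; approx = λ k _ → above k }
  where
  above : ∀ k → ∃ λ x → S x × k < x
  above k with em {∃ λ x → S x × k < x}
  ... | yes found = found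
  ... | no  none  = ⊥-elim (unbounded (k , λ x∈S → ≮⇒≥ λ k<x → none (_ , x∈S , k<x)))

-- s = Single(n, A)
IsSingle : ℕ → Pred ℕ 0ℓ → ℕ ⁺ → Set
IsSingle n A = IsSupremum (SingleValue n A)

record IsSortedValues {n} (P : Board n) (v : Vec ℕ n) : Set where
  field
    sorted    : Sorting.Sorted ≤-totalOrder (toList v)
    rearrange : toList v ↭ toList (map value P)

{-# OPTIONS --safe #-}
module Submission where

-- Call x buildable on k cells if x ∈ A and x = 1 + Σ tⱼ for fewer than k tiles,
-- where each tⱼ is in turn buildable on the cells that t₁, …, tⱼ₋₁ leave free.  A
-- buildable x is made by making the tⱼ in order, placing a last 1 and merging
-- everything.  Conversely, the tiles of every reachable position admit an order in
-- which each is buildable on the cells left free by its predecessors: a new 1 goes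
-- last, and a merged group takes the place of its first member, on whose cells the
-- whole group can be made.  Hence Single(k) is governed by buildability on k cells,
-- and among the n - i + 1 tiles ≥ vᵢ the last one in the order is buildable on i
-- cells.  In the other direction, undoing the last 1 repeatedly decreases the sum by
-- one each time, so every y ∈ A below a buildable x is buildable on the same cells,
-- and the position is made from its largest tile downwards.

open import Defs
open import Data.Bool.Base using (if_then_else_)
open import Data.Empty using (⊥-elim)
open import Data.Fin.Base using (Fin; zero; suc; toℕ; fromℕ; inject₁)
open import Data.Fin.Properties using (toℕ-fromℕ; toℕ-inject₁; toℕ<n; _≟_)
open import Data.Fin.Subset using (Subset; _∈_; _∉_; _∩_; ∁; Empty; inside; outside)
open import Data.Fin.Subset.Properties using (_∈?_; x∈p∩q⁺; x∈p⇒x∉∁p; x∉p⇒x∈∁p)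
open import Data.List.Base as List
  using (List; []; _∷_; _∷ʳ_; catMaybes; filter; length)
import Data.List.Membership.Propositional as List
open import Data.List.Membership.Propositional.Properties using (∈-map⁺; ∈-map⁻)
open import Data.List.Properties using (length-++; filter-all; filter-reject; filter-accept)
open import Data.List.Relation.Binary.Permutation.Propositional
  using (_↭_; refl; prep; swap; trans; ↭-sym; ↭-trans; ↭-reflexive
        ; module PermutationReasoning)
open import Data.List.Relation.Binary.Permutation.Propositional.Properties
  using (All-resp-↭; ↭-length; ↭-singleton-inv; ∷↭∷ʳ; filter-↭; catMaybes-↭; map⁺)
import Data.List.Relation.Unary.All as ListAll
open import Data.List.Relation.Unary.AllPairs as AllPairs using (AllPairs; []; _∷_)
import Data.List.Relation.Unary.AllPairs.Properties as AllPairs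
open import Data.List.Relation.Unary.Any using (here; there)
open import Data.List.Relation.Unary.Sorted.TotalOrder.Properties using (Sorted⇒AllPairs)
open import Data.List.Relation.Ternary.Interleaving.Propositional
  using (Interleaving; []; consˡ; consʳ)
  renaming (swap to swapᵢ)
open import Data.Maybe.Base using (Maybe; just; nothing; is-just)
open import Data.Maybe using (Is-just)
import Data.Maybe.Relation.Unary.All as Maybe
import Data.Maybe.Relation.Unary.Any as MaybeAny
open import Data.Nat.Base using (ℕ; zero; suc; _+_; _≤_; _<_; z≤n; s≤s; s≤s⁻¹; z<s)
open import Data.Nat.ListAction using (sum)
open import Data.Nat.ListAction.Properties using (sum-↭; sum-++)
open import Data.Nat.Properties
  using (≤-refl; ≤-reflexive; ≤-trans; <⇒≤; m≤n⇒m≤1+n; n≤1+n; ≤-totalOrder; _≤?_; n≮0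
        ; +-suc; +-comm; +-identityʳ; +-monoˡ-≤; +-cancelʳ-<; suc-injective; m≤n⇒∃[o]m+o≡n
        ; module ≤-Reasoning)
open import Data.Product.Base using (∃; _×_; _,_)
open import Data.Sum.Base using (_⊎_; inj₁; inj₂)
open import Data.Vec.Base as Vec
  using (Vec; []; _∷_; lookup; toList; zipWith; _[_]≔_; initLast)
open import Data.Vec.Properties
  using (lookup∘update; lookup∘update′; lookup-replicate
        ; tabulate∘lookup; tabulate-cong; length-toList; toList-∷ʳ)
open import Data.Vec.Membership.Propositional.Properties using (∈-lookup; ∈-toList⁺)
open import Data.Vec.Relation.Unary.All using ([]; _∷_)
open import Function.Base using (_∘_)
open import Function.Bundles using (_⇔_; mk⇔)
open import Level using (0ℓ)
open import Relation.Binary.Construct.Closure.ReflexiveTransitive using (Star; ε; _◅_; _◅◅_; gmap)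
open import Relation.Binary.PropositionalEquality
  using (_≡_; _≢_; refl; sym; cong; cong₂; subst; subst₂; module ≡-Reasoning)
  renaming (trans to ≡-trans)
open import Relation.Binary.Construct.Add.Supremum.NonStrict _≤_ using (≤⁺-trans)
open import Relation.Nullary.Decidable.Core using (yes; no)
open import Relation.Unary using (Pred)

-- Interleavings up to permutation

-- A merge splits the tiles in the order of the cells, whereas construction follows an order of its
-- own; this carries the split from one order to the other.
Interleaving-resp-↭ : ∀ {X : Set} {ls rs xs ys : List X} → xs ↭ ys → Interleaving ls rs xs →
                      ∃ λ ls′ → ∃ λ rs′ → ls′ ↭ ls × rs′ ↭ rs × Interleaving ls′ rs′ ys
Interleaving-resp-↭ refl i = _ , _ , refl , refl , i
Interleaving-resp-↭ (prep x p) (consˡ i) with Interleaving-resp-↭ p i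
... | _ , _ , l , r , i′ = _ , _ , prep x l , r , consˡ i′
Interleaving-resp-↭ (prep x p) (consʳ i) with Interleaving-resp-↭ p i
... | _ , _ , l , r , i′ = _ , _ , l , prep x r , consʳ i′
Interleaving-resp-↭ (swap x y p) (consˡ (consˡ i)) with Interleaving-resp-↭ p i
... | _ , _ , l , r , i′ = _ , _ , swap y x l , r , consˡ (consˡ i′)
Interleaving-resp-↭ (swap x y p) (consˡ (consʳ i)) with Interleaving-resp-↭ p i
... | _ , _ , l , r , i′ = _ , _ , prep x l , prep y r , consʳ (consˡ i′)
Interleaving-resp-↭ (swap x y p) (consʳ (consˡ i)) with Interleaving-resp-↭ p i
... | _ , _ , l , r , i′ = _ , _ , prep y l , prep x r , consˡ (consʳ i′)
Interleaving-resp-↭ (swap x y p) (consʳ (consʳ i)) with Interleaving-resp-↭ p i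
... | _ , _ , l , r , i′ = _ , _ , l , swap y x r , consʳ (consʳ i′)
Interleaving-resp-↭ (trans p q) i with Interleaving-resp-↭ p i
... | _ , _ , l , r , i′ with Interleaving-resp-↭ q i′
... | _ , _ , l′ , r′ , i″ = _ , _ , ↭-trans l′ l , ↭-trans r′ r , i″

-- Boards and their tiles

tiles : ∀ {n} → Board n → List ℕ
tiles P = catMaybes (toList P)

keep : ∀ {n} → Subset n → Board n → Board n
keep S P = zipWith (λ inside? c → if inside? then c else nothing) S P

lookup-keep-∈ : ∀ {n} {S : Subset n} (P : Board n) {j} → j ∈ S → lookup (keep S P) j ≡ lookup P j
lookup-keep-∈ (_ ∷ _) {zero}  Vec.here        = refl
lookup-keep-∈ (_ ∷ P) {suc j} (Vec.there j∈S) = lookup-keep-∈ P j∈S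

lookup-keep-∉ : ∀ {n} {S : Subset n} (P : Board n) {j} → j ∉ S → lookup (keep S P) j ≡ nothing
lookup-keep-∉ {S = inside  ∷ _} (_ ∷ _) {zero}  j∉S = ⊥-elim (j∉S Vec.here)
lookup-keep-∉ {S = outside ∷ _} (_ ∷ _) {zero}  j∉S = refl
lookup-keep-∉ {S = _       ∷ _} (_ ∷ P) {suc j} j∉S = lookup-keep-∉ P (j∉S ∘ Vec.there)

tiles-keep-interleaving : ∀ {n} (S : Subset n) (P : Board n) →
                          Interleaving (tiles (keep S P)) (tiles (keep (∁ S) P)) (tiles P)
tiles-keep-interleaving []            []            = []
tiles-keep-interleaving (inside  ∷ S) (nothing ∷ P) = tiles-keep-interleaving S P
tiles-keep-interleaving (inside  ∷ S) (just _  ∷ P) = consˡ (tiles-keep-interleaving S P)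
tiles-keep-interleaving (outside ∷ S) (nothing ∷ P) = tiles-keep-interleaving S P
tiles-keep-interleaving (outside ∷ S) (just _  ∷ P) = consʳ (tiles-keep-interleaving S P)

total≡sum-keep : ∀ {n} (P : Board n) (S : Subset n) → total P S ≡ sum (tiles (keep S P))
total≡sum-keep []            []            = refl
total≡sum-keep (nothing ∷ P) (inside  ∷ S) = total≡sum-keep P S
total≡sum-keep (just x  ∷ P) (inside  ∷ S) = cong (x +_) (total≡sum-keep P S)
total≡sum-keep (_       ∷ P) (outside ∷ S) = total≡sum-keep P S

total-cong : ∀ {n} (P Q : Board n) (S : Subset n) →
             (∀ {j} → j ∈ S → lookup P j ≡ lookup Q j) → total P S ≡ total Q S
total-cong []      []      []            P≗Q = refl
total-cong (_ ∷ P) (_ ∷ Q) (inside  ∷ S) P≗Q =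
  cong₂ _+_ (cong value (P≗Q Vec.here)) (total-cong P Q S (P≗Q ∘ Vec.there))
total-cong (_ ∷ P) (_ ∷ Q) (outside ∷ S) P≗Q = total-cong P Q S (P≗Q ∘ Vec.there)

tiles-place : ∀ {n} (P : Board n) {c x} → lookup P c ≡ nothing →
              tiles (P [ c ]≔ just x) ↭ x ∷ tiles P
tiles-place (nothing ∷ P) {zero}  refl = refl
tiles-place (nothing ∷ P) {suc c} free = tiles-place P free
tiles-place (just y  ∷ P) {suc c} free =
  trans (prep y (tiles-place P free)) (swap y _ refl)

length-tiles≤ : ∀ {n} (P : Board n) → length (tiles P) ≤ n
length-tiles≤ []            = z≤n
length-tiles≤ (nothing ∷ P) = m≤n⇒m≤1+n (length-tiles≤ P)
length-tiles≤ (just _  ∷ P) = s≤s (length-tiles≤ P)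

length-tiles< : ∀ {n} (P : Board n) {c} → lookup P c ≡ nothing → length (tiles P) < n
length-tiles< (nothing ∷ P) {zero}  _    = s≤s (length-tiles≤ P)
length-tiles< (nothing ∷ P) {suc c} free = m≤n⇒m≤1+n (length-tiles< P free)
length-tiles< (just _  ∷ P) {suc c} free = s≤s (length-tiles< P free)

tiles-emptyBoard : ∀ n → tiles (emptyBoard n) ≡ []
tiles-emptyBoard zero    = refl
tiles-emptyBoard (suc n) = tiles-emptyBoard n

lookup-ext : ∀ {n} {P Q : Board n} → (∀ j → lookup P j ≡ lookup Q j) → P ≡ Q
lookup-ext {P = P} {Q} P≗Q = begin
  P                        ≡⟨ tabulate∘lookup P ⟨
  Vec.tabulate (lookup P)  ≡⟨ tabulate-cong P≗Q ⟩
  Vec.tabulate (lookup Q)  ≡⟨ tabulate∘lookup Q ⟩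
  Q                        ∎
  where open ≡-Reasoning

-- fill k ts puts ts on the first cells of k; tiles that do not fit are lost.
fill : ∀ k → List ℕ → Board k
fill k       []       = emptyBoard k
fill zero    (_ ∷ _)  = []
fill (suc k) (t ∷ ts) = just t ∷ fill k ts

tiles-fill : ∀ k ts → length ts ≤ k → tiles (fill k ts) ≡ ts
tiles-fill k       []       _         = tiles-emptyBoard k
tiles-fill (suc k) (t ∷ ts) (s≤s len) = cong (t ∷_) (tiles-fill k ts len)

fill-∷ʳ : ∀ k ts x → length ts < k →
          ∃ λ c → lookup (fill k ts) c ≡ nothing × fill k ts [ c ]≔ just x ≡ fill k (ts ∷ʳ x)
fill-∷ʳ (suc k) []       x _         = zero , refl , refl
fill-∷ʳ (suc k) (t ∷ ts) x (s≤s len) with fill-∷ʳ k ts x len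
... | c , free , eq = suc c , free , cong (just t ∷_) eq

support : ∀ {n} → Board n → Subset n
support = Vec.map is-just

∈-support : ∀ {n} (P : Board n) {j} → j ∈ support P → Is-just (lookup P j)
∈-support (just _ ∷ P) {zero}  Vec.here       = MaybeAny.just _
∈-support (_      ∷ P) {suc j} (Vec.there j∈) = ∈-support P j∈

∉-support : ∀ {n} (P : Board n) {j} → j ∉ support P → lookup P j ≡ nothing
∉-support (nothing ∷ P) {zero}  j∉ = refl
∉-support (just _  ∷ P) {zero}  j∉ = ⊥-elim (j∉ Vec.here)
∉-support (_       ∷ P) {suc j} j∉ = ∉-support P (j∉ ∘ Vec.there)

total-support : ∀ {n} (P : Board n) → total P (support P) ≡ sum (tiles P)
total-support []            = refl
total-support (nothing ∷ P) = total-support P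
total-support (just x  ∷ P) = cong (x +_) (total-support P)

-- The effect of a single block, so that a simultaneous merge can be taken apart block by block.
contract : ∀ {n} → Board n → Block n → Board n
contract P b = keep (∁ (cells b)) P [ target b ]≔ just (total P (cells b))

module _ {n} (P : Board n) (b : Block n) where

  contract-target : lookup (contract P b) (target b) ≡ just (total P (cells b))
  contract-target = lookup∘update (target b) (keep (∁ (cells b)) P) _

  contract-vacated : ∀ {j} → j ∈ cells b → j ≢ target b → lookup (contract P b) j ≡ nothing
  contract-vacated j∈ j≢ =
    ≡-trans (lookup∘update′ j≢ (keep (∁ (cells b)) P) _) (lookup-keep-∉ P (x∈p⇒x∉∁p j∈))

  contract-untouched : ∀ {j} → j ∉ cells b → lookup (contract P b) j ≡ lookup P j
  contract-untouched j∉ =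
    ≡-trans (lookup∘update′ (λ { refl → j∉ (target∈ b) }) (keep (∁ (cells b)) P) _)
            (lookup-keep-∈ P (x∉p⇒x∈∁p j∉))

  tiles-contract : tiles (contract P b) ↭
                   sum (tiles (keep (cells b) P)) ∷ tiles (keep (∁ (cells b)) P)
  tiles-contract =
    subst (λ x → tiles (contract P b) ↭ x ∷ tiles (keep (∁ (cells b)) P))
          (total≡sum-keep P (cells b))
          (tiles-place (keep (∁ (cells b)) P) (lookup-keep-∉ P (x∈p⇒x∉∁p (target∈ b))))

-- Numbers of large tiles

count≥ : ℕ → List ℕ → ℕ
count≥ a xs = length (filter (a ≤?_) xs)

count≥-↭ : ∀ a {xs ys} → xs ↭ ys → count≥ a xs ≡ count≥ a ys
count≥-↭ a p = ↭-length (filter-↭ (a ≤?_) p)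

count≥-∷ : ∀ a x xs → count≥ a xs ≤ count≥ a (x ∷ xs)
count≥-∷ a x xs with a ≤? x
... | yes a≤x = ≤-trans (n≤1+n _) (≤-reflexive (sym (cong length (filter-accept (a ≤?_) a≤x))))
... | no  a≰x = ≤-reflexive (sym (cong length (filter-reject (a ≤?_) a≰x)))

-- The threshold is a successor, so the zeros standing for empty cells are not counted.
count≥-tiles : ∀ a {n} (P : Board n) →
               count≥ (suc a) (toList (Vec.map value P)) ≡ count≥ (suc a) (tiles P)
count≥-tiles a []            = refl
count≥-tiles a (nothing ∷ P) =
  ≡-trans (cong length (filter-reject (suc a ≤?_) {x = 0} {xs = toList (Vec.map value P)} λ ()))
          (count≥-tiles a P)
count≥-tiles a (just x  ∷ P) with suc a ≤? x
... | yes a≤x = begin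
  count≥ (suc a) (x ∷ toList (Vec.map value P))  ≡⟨ cong length (filter-accept (suc a ≤?_) a≤x) ⟩
  suc (count≥ (suc a) (toList (Vec.map value P)))  ≡⟨ cong suc (count≥-tiles a P) ⟩
  suc (count≥ (suc a) (tiles P)) ≡⟨ cong length (filter-accept (suc a ≤?_) a≤x) ⟨
  count≥ (suc a) (x ∷ tiles P) ∎
  where open ≡-Reasoning
... | no  a≰x = begin
  count≥ (suc a) (x ∷ toList (Vec.map value P))  ≡⟨ cong length (filter-reject (suc a ≤?_) a≰x) ⟩
  count≥ (suc a) (toList (Vec.map value P))  ≡⟨ count≥-tiles a P ⟩
  count≥ (suc a) (tiles P) ≡⟨ cong length (filter-reject (suc a ≤?_) a≰x) ⟨
  count≥ (suc a) (x ∷ tiles P) ∎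
  where open ≡-Reasoning

-- With positions counted from 0, the `n - i` entries from position `i` on are all at least
-- `lookup v i`; the additive form avoids subtraction.
count≥-sorted : ∀ {n} (v : Vec ℕ n) → AllPairs _≤_ (toList v) →
                ∀ i → n ≤ count≥ (lookup v i) (toList v) + toℕ i
count≥-sorted {suc n} (x ∷ v) (x≤v ∷ _) zero = ≤-reflexive (begin
  suc n                             ≡⟨ length-toList (x ∷ v) ⟨
  length (x ∷ toList v)             ≡⟨ cong length (filter-all (x ≤?_) (≤-refl ListAll.∷ x≤v)) ⟨
  count≥ x (x ∷ toList v)           ≡⟨ +-identityʳ _ ⟨
  count≥ x (x ∷ toList v) + 0       ∎)
  where open ≡-Reasoning
count≥-sorted {suc n} (x ∷ v) (_ ∷ sorted) (suc i) = begin
  suc n                                               ≤⟨ s≤s (count≥-sorted v sorted i) ⟩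
  suc (count≥ (lookup v i) (toList v) + toℕ i)        ≡⟨ +-suc _ (toℕ i) ⟨
  count≥ (lookup v i) (toList v) + suc (toℕ i)        ≤⟨ +-monoˡ-≤ _ (count≥-∷ (lookup v i) x (toList v)) ⟩
  count≥ (lookup v i) (x ∷ toList v) + suc (toℕ i)    ∎
  where open ≤-Reasoning

-- Vector ends, the order with infinity, and cells recovered from values

lookup-∷ʳ-inject₁ : ∀ {X : Set} {n} (xs : Vec X n) x i →
                    lookup (xs Vec.∷ʳ x) (inject₁ i) ≡ lookup xs i
lookup-∷ʳ-inject₁ (_ ∷ xs) x zero    = refl
lookup-∷ʳ-inject₁ (_ ∷ xs) x (suc i) = lookup-∷ʳ-inject₁ xs x i

lookup-∷ʳ-fromℕ : ∀ {X : Set} {n} (xs : Vec X n) x → lookup (xs Vec.∷ʳ x) (fromℕ n) ≡ x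
lookup-∷ʳ-fromℕ []       x = refl
lookup-∷ʳ-fromℕ (_ ∷ xs) x = lookup-∷ʳ-fromℕ xs x

0≤⁺ : ∀ s → [ 0 ] ≤⁺ s
0≤⁺ [ _ ] = [ z≤n ]
0≤⁺ ⊤⁺    = _ ≤⊤⁺

suc≤⁺⇒<⁺ : ∀ {a s} → [ suc a ] ≤⁺ s → [ a ] <⁺ s
suc≤⁺⇒<⁺ [ a<k ]    = [ a<k ]
suc≤⁺⇒<⁺ (_ ≤⊤⁺)    = [ _ ]<⊤⁺

-- Inverse to `value` on positions whose tiles are positive, where 0 can only mean an empty cell.
cell : ℕ → Maybe ℕ
cell zero    = nothing
cell (suc x) = just (suc x)

cell-value : ∀ {A : Pred ℕ 0ℓ} → (∀ {x} → A x → 0 < x) → ∀ {n} {P : Board n} → IsPosition A P →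
             List.map cell (toList (Vec.map value P)) ≡ toList P
cell-value pos []                        = refl
cell-value pos (Maybe.nothing ∷ P∈A)     = cong (nothing ∷_) (cell-value pos P∈A)
cell-value pos (_∷_ {x = just zero}    (Maybe.just 0∈A) _)   = ⊥-elim (n≮0 (pos 0∈A))
cell-value pos (_∷_ {x = just (suc x)} (Maybe.just _)   P∈A) = cong (just (suc x) ∷_) (cell-value pos P∈A)

position-values : ∀ {A : Pred ℕ 0ℓ} {n} {P : Board n} → IsPosition A P →
                  ListAll.All (λ x → x ≡ 0 ⊎ A x) (toList (Vec.map value P))
position-values []                     = ListAll.[]
position-values (Maybe.nothing  ∷ P∈A) = inj₁ refl ListAll.∷ position-values P∈A
position-values (Maybe.just x∈A ∷ P∈A) = inj₂ x∈A ListAll.∷ position-values P∈A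

-- Buildable values

module _ (A : Pred ℕ 0ℓ) where

  mutual

    -- Builds k x: a single tile x can be made on k otherwise empty cells, by
    -- placing tiles xs on fewer than k of them and merging these with a final 1.
    data Builds (k : ℕ) (x : ℕ) : Set where
      tile : ∀ {xs} → BuildsAll k xs → length xs < k → x ≡ suc (sum xs) → A x → Builds k x

    -- The tiles are made in the listed order, each in the cells still free.
    data BuildsAll : ℕ → List ℕ → Set where
      []  : ∀ {k} → BuildsAll k []
      _∷_ : ∀ {k x xs} → Builds (suc k) x → BuildsAll k xs → BuildsAll (suc k) (x ∷ xs)

  Constructible : ℕ → List ℕ → Set
  Constructible k ts = ∃ λ ts′ → ts′ ↭ ts × BuildsAll k ts′

  private variable
    k n x y : ℕ
    xs ys ts : List ℕ

  Builds⇒A : Builds k x → A x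
  Builds⇒A (tile _ _ _ x∈A) = x∈A

  mutual

    Builds-suc : Builds k x → Builds (suc k) x
    Builds-suc (tile bs len eq x∈A) = tile (BuildsAll-suc bs) (m≤n⇒m≤1+n len) eq x∈A

    BuildsAll-suc : BuildsAll k xs → BuildsAll (suc k) xs
    BuildsAll-suc []       = []
    BuildsAll-suc (b ∷ bs) = Builds-suc b ∷ BuildsAll-suc bs

  Builds-mono : ∀ {m} → k ≤ m → Builds k x → Builds m x
  Builds-mono {k} {x} k≤m b with m≤n⇒∃[o]m+o≡n k≤m
  ... | o , refl = subst (λ m → Builds m x) (+-comm o k) (go o)
    where
    go : ∀ o → Builds (o + k) x
    go zero    = b
    go (suc o) = Builds-suc (go o)

  -- The last tile can be undone to the moment before its final 1 is placed.
  BuildsAll-pred : BuildsAll k (x ∷ xs) → ∃ λ ys →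
                   BuildsAll k ys × length ys < k × sum (x ∷ xs) ≡ suc (sum ys)
  BuildsAll-pred (tile {ys} bs len refl _ ∷ []) = ys , bs , len , +-identityʳ _
  BuildsAll-pred {x = x} (b ∷ bs@(_ ∷ _)) with BuildsAll-pred bs
  ... | ys , bs′ , len , eq =
    x ∷ ys , b ∷ bs′ , s≤s len , ≡-trans (cong (x +_) eq) (+-suc x (sum ys))

  -- Once the final 1 is undone, fewer than `k` tiles remain, and these together with that 1 are
  -- what `tile` merges.
  Builds-sum : BuildsAll k (x ∷ xs) → A (sum (x ∷ xs)) → Builds k (sum (x ∷ xs))
  Builds-sum bs s∈A with BuildsAll-pred bs
  ... | ys , bs′ , len , eq = tile bs′ len eq s∈A

  -- `BuildsAll-pred` lowers the sum by exactly one, so its iteration meets every value from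
  -- `sum xs` down to 0.
  BuildsAll-truncate : BuildsAll k xs → y ≤ sum xs → ∃ λ ys → BuildsAll k ys × sum ys ≡ y
  BuildsAll-truncate {k} {y = y} bs y≤s with m≤n⇒∃[o]m+o≡n y≤s
  ... | d , eq = go d bs (≡-trans (sym eq) (+-comm y d))
    where
    go : ∀ d {xs} → BuildsAll k xs → sum xs ≡ d + y → ∃ λ ys → BuildsAll k ys × sum ys ≡ y
    go zero    bs         eq = _ , bs , eq
    go (suc d) bs@(_ ∷ _) eq with BuildsAll-pred bs
    ... | ys , bs′ , _ , eq′ = go d bs′ (suc-injective (≡-trans (sym eq′) eq))

  -- Truncate the one-tile list of `x` to sum `y` and merge what is left; positivity of `y` ensures
  -- that something is left.
  Builds-down : Builds (suc k) x → 0 < y → A y → y ≤ x → Builds (suc k) y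
  Builds-down b 0<y y∈A y≤x
    with BuildsAll-truncate (b ∷ []) (≤-trans y≤x (≤-reflexive (sym (+-identityʳ _))))
  ... | []    , _  , refl = ⊥-elim (n≮0 0<y)
  ... | _ ∷ _ , bs , refl = Builds-sum bs y∈A

  -- Leaving out a tile only gives the later ones an extra cell.
  BuildsAll-left : Interleaving xs ys ts → BuildsAll k ts → BuildsAll k xs
  BuildsAll-left []        []       = []
  BuildsAll-left (consˡ i) (b ∷ bs) = b ∷ BuildsAll-left i bs
  BuildsAll-left (consʳ i) (b ∷ bs) = BuildsAll-suc (BuildsAll-left i bs)

  -- The first tile of the merged group had the most cells at its disposal, and
  -- the whole group can be made in those cells.
  merge-constructible : (∀ {x} → A x → 0 < x) → Interleaving xs ys ts → BuildsAll k ts →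
                        A (sum xs) → Constructible k (sum xs ∷ ys)
  merge-constructible pos []        []       s∈A = ⊥-elim (n≮0 (pos s∈A))
  merge-constructible pos (consˡ i) (b ∷ bs) s∈A =
    -- The tiles outside the group all come after `b`, so they can be made with one cell occupied by
    -- the merged tile.
    _ , refl , Builds-sum (b ∷ BuildsAll-left i bs) s∈A ∷ BuildsAll-left (swapᵢ i) bs
  merge-constructible {ts = y ∷ _} pos (consʳ i) (b ∷ bs) s∈A with merge-constructible pos i bs s∈A
  ... | ts , p , bs′ = y ∷ ts , ↭-trans (prep y p) (swap y _ refl) , b ∷ bs′

  -- A bare 1 needs just one free cell, and `length xs < k` leaves one after all of `xs`.
  place-constructible : A 1 → BuildsAll k xs → length xs < k → BuildsAll k (xs ∷ʳ 1)
  place-constructible A1 []       (s≤s _)   = tile [] z<s refl A1 ∷ []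
  place-constructible A1 (b ∷ bs) (s≤s len) = b ∷ place-constructible A1 bs len

  -- From plays to buildable values

  contract-constructible : (∀ {x} → A x → 0 < x) → (P : Board n) (b : Block n) →
                           A (total P (cells b)) → Constructible n (tiles P) →
                           Constructible n (tiles (contract P b))
  contract-constructible pos P b s∈A (ts , p , bs)
    with Interleaving-resp-↭ (↭-sym p) (tiles-keep-interleaving (cells b) P)
  ... | xs , ys , xs↭ , ys↭ , i
    with merge-constructible pos i bs
           (subst A (≡-trans (total≡sum-keep P (cells b)) (sum-↭ (↭-sym xs↭))) s∈A)
  ... | ts′ , p′ , bs′ = ts′ , q , bs′
    where
    open PermutationReasoning
    q = begin
      ts′                        ↭⟨ p′ ⟩
      sum xs ∷ ys                ↭⟨ prep _ ys↭ ⟩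
      sum xs ∷ tiles (keep (∁ (cells b)) P)
        ≡⟨ cong (_∷ tiles (keep (∁ (cells b)) P)) (sum-↭ xs↭) ⟩
      sum (tiles (keep (cells b) P)) ∷ tiles (keep (∁ (cells b)) P)  ↭⟨ tiles-contract P b ⟨
      tiles (contract P b)       ∎

  -- Induction on the blocks: after contracting the first one, the others still form a merge with
  -- the same outcome `Q`, because they are disjoint from it.
  Merge-constructible : (∀ {x} → A x → 0 < x) → {P Q : Board n} →
                        Merge A P Q → Constructible n (tiles P) → Constructible n (tiles Q)
  Merge-constructible {n} pos m = go (Merge.blocks m) m refl
    where
    go : ∀ bs {P Q : Board n} (m : Merge A P Q) → Merge.blocks m ≡ bs →
         Constructible n (tiles P) → Constructible n (tiles Q)
    go [] {P} {Q} m refl =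
      subst (Constructible n ∘ tiles) (lookup-ext {P = P} {Q} λ j → sym (Merge.untouched m λ ()))
    go (b ∷ bs) {P} {Q} m@record { disjoint = b∩bs ∷ disj } refl =
      go bs m′ refl ∘ contract-constructible pos P b (Merge.allowed m (here refl))
      where
      unaffected : ∀ {c} → c List.∈ bs → ∀ {j} → j ∈ cells c →
                   lookup (contract P b) j ≡ lookup P j
      unaffected c∈ j∈c = contract-untouched P b λ j∈b →
        ListAll.lookup b∩bs c∈ (_ , x∈p∩q⁺ (j∈b , j∈c))

      total-unaffected : ∀ {c} → c List.∈ bs →
                         total P (cells c) ≡ total (contract P b) (cells c)
      total-unaffected {c} c∈ =
        total-cong P (contract P b) (cells c) (sym ∘ unaffected c∈)

      -- A cell of `b` lies outside the remaining blocks, so the contraction must already have given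
      -- it its content in `Q`; `merged` and `vacated` say that it has.
      rest-untouched : ∀ {j} → (∀ {c} → c List.∈ bs → j ∉ cells c) →
                       lookup Q j ≡ lookup (contract P b) j
      rest-untouched {j} j∉bs with j ∈? cells b
      ... | no j∉b = ≡-trans
        (Merge.untouched m λ { (here refl) → j∉b ; (there c∈) → j∉bs c∈ })
        (sym (contract-untouched P b j∉b))
      ... | yes j∈b with j ≟ target b
      ... | yes refl = ≡-trans (Merge.merged m (here refl)) (sym (contract-target P b))
      ... | no  j≢t  =
        ≡-trans (Merge.vacated m (here refl) j∈b j≢t) (sym (contract-vacated P b j∈b j≢t))

      m′ : Merge A (contract P b) Q
      m′ = record
        { blocks    = bs
        ; disjoint  = disj
        ; nonempty  = λ c∈ j∈c →
            subst Is-just (sym (unaffected c∈ j∈c)) (Merge.nonempty m (there c∈) j∈c)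
        ; allowed   = λ c∈ → subst A (total-unaffected c∈) (Merge.allowed m (there c∈))
        ; merged    = λ c∈ → ≡-trans (Merge.merged m (there c∈)) (cong just (total-unaffected c∈))
        ; vacated   = λ c∈ → Merge.vacated m (there c∈)
        ; untouched = rest-untouched
        }

  Step-constructible : (∀ {x} → A x → 0 < x) → A 1 → {P Q : Board n} →
                       Step A P Q → Constructible n (tiles P) → Constructible n (tiles Q)
  Step-constructible {n} pos A1 {P} (c , free , m) (ts , p , bs) =
    Merge-constructible pos m (ts ∷ʳ 1 , q , place-constructible A1 bs len)
    where
    len : length ts < n
    len = subst (_< n) (sym (↭-length p)) (length-tiles< P free)
    q : ts ∷ʳ 1 ↭ tiles (P [ c ]≔ just 1)
    q = ↭-trans (↭-sym (∷↭∷ʳ 1 ts)) (↭-trans (prep 1 p) (↭-sym (tiles-place P free)))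

  Reachable⇒Constructible : (∀ {x} → A x → 0 < x) → A 1 → {P : Board n} →
                            Reachable A P → Constructible n (tiles P)
  Reachable⇒Constructible {n} pos A1 (Q , play , Q≈P) =
    let ts , p , bs = go play ([] , ↭-reflexive (sym (tiles-emptyBoard n)) , [])
    in  ts , ↭-trans p (catMaybes-↭ Q≈P) , bs
    where
    go : ∀ {P Q : Board n} → Star (Step A) P Q →
         Constructible n (tiles P) → Constructible n (tiles Q)
    go ε       = λ c → c
    go (s ◅ p) = go p ∘ Step-constructible pos A1 s

  -- From buildable values to plays

  shift : Block n → Block (suc n)
  shift b = record
    { cells   = outside ∷ cells b
    ; target  = suc (target b)
    ; target∈ = Vec.there (target∈ b)
    }

  Merge-∷ : ∀ c {P Q : Board n} → Merge A P Q → Merge A (c ∷ P) (c ∷ Q)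
  Merge-∷ {n} c {P} {Q} m = record
    { blocks    = List.map shift blocks
    ; disjoint  = AllPairs.map⁺ (AllPairs.map (λ {b} {c} → shift-disjoint {b} {c}) disjoint)
    ; nonempty  = nonempty′
    ; allowed   = allowed′
    ; merged    = merged′
    ; vacated   = vacated′
    ; untouched = λ
      { {zero}  _  → refl
      ; {suc j} j∉ → untouched λ b∈ j∈ → j∉ (∈-map⁺ shift b∈) (Vec.there j∈)
      }
    }
    where
    open Merge m

    shift-disjoint : ∀ {b c : Block n} → Empty (cells b ∩ cells c) →
                     Empty (cells (shift b) ∩ cells (shift c))
    shift-disjoint empty (suc j , Vec.there j∈) = empty (j , j∈)

    nonempty′ : ∀ {b} → b List.∈ List.map shift blocks → ∀ {j} → j ∈ cells b →
                Is-just (lookup (c ∷ P) j)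
    nonempty′ b∈ j∈ with ∈-map⁻ shift b∈
    nonempty′ _ (Vec.there j∈) | _ , b∈ , refl = nonempty b∈ j∈

    allowed′ : ∀ {b} → b List.∈ List.map shift blocks → A (total (c ∷ P) (cells b))
    allowed′ b∈ with ∈-map⁻ shift b∈
    ... | _ , b∈ , refl = allowed b∈

    merged′ : ∀ {b} → b List.∈ List.map shift blocks →
              lookup (c ∷ Q) (target b) ≡ just (total (c ∷ P) (cells b))
    merged′ b∈ with ∈-map⁻ shift b∈
    ... | _ , b∈ , refl = merged b∈

    vacated′ : ∀ {b} → b List.∈ List.map shift blocks → ∀ {j} → j ∈ cells b → j ≢ target b →
               lookup (c ∷ Q) j ≡ nothing
    vacated′ b∈ j∈ j≢ with ∈-map⁻ shift b∈
    vacated′ _ (Vec.there j∈) j≢ | _ , b∈ , refl = vacated b∈ j∈ (j≢ ∘ cong suc)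

  -- A cell that no block meets is inert, so a finished tile can wait in front while play continues
  -- in the other cells.
  play-∷ : ∀ c {P Q : Board n} → Star (Step A) P Q → Star (Step A) (c ∷ P) (c ∷ Q)
  play-∷ c = gmap (c ∷_) λ (i , free , m) → suc i , free , Merge-∷ c m

  -- The head cell carries a tile, hence belongs to the block of all nonempty cells and can be its
  -- target.
  mergeAll : (P : Board n) → A (x + sum (tiles P)) →
             Merge A (just x ∷ P) (just (x + sum (tiles P)) ∷ emptyBoard n)
  mergeAll {n} {x} P s∈A = record
    { blocks    = b ∷ []
    ; disjoint  = ListAll.[] ∷ []
    ; nonempty  = λ { (here refl) → ∈-support (just x ∷ P) }
    ; allowed   = λ { (here refl) → subst A (sym total≡) s∈A }
    ; merged    = λ { (here refl) → cong just (sym total≡) }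
    ; vacated   = λ { (here refl) {zero}  _ j≢0 → ⊥-elim (j≢0 refl)
                    ; (here refl) {suc j} _ _   → lookup-replicate j nothing }
    ; untouched = untouched
    }
    where
    b : Block (suc n)
    b = record { cells = support (just x ∷ P) ; target = zero ; target∈ = Vec.here }

    total≡ : total (just x ∷ P) (cells b) ≡ x + sum (tiles P)
    total≡ = total-support (just x ∷ P)

    untouched : ∀ {j} → (∀ {c} → c List.∈ b ∷ [] → j ∉ cells c) →
                lookup (just (x + sum (tiles P)) ∷ emptyBoard n) j ≡ lookup (just x ∷ P) j
    untouched {zero}  j∉ = ⊥-elim (j∉ (here refl) Vec.here)
    untouched {suc j} j∉ =
      ≡-trans (lookup-replicate j nothing) (sym (∉-support (just x ∷ P) (j∉ (here refl))))

  -- The upper bound on the length keeps `fill` from losing tiles, and the lower one provides the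
  -- head tile for `mergeAll`.
  merge-fill : ∀ ts → 0 < length ts → length ts ≤ suc k → A (sum ts) →
               Merge A (fill (suc k) ts) (just (sum ts) ∷ emptyBoard k)
  merge-fill {k} (t ∷ ts) _ (s≤s len) s∈A =
    subst (λ us → Merge A (just t ∷ fill k ts) (just (t + sum us) ∷ emptyBoard k)) (tiles-fill k ts len)
      (mergeAll (fill k ts) (subst (λ us → A (t + sum us)) (sym (tiles-fill k ts len)) s∈A))

  mutual

    -- The recipe is played literally: `xs` on the first cells, the final 1 on the next one, then a
    -- merge of everything into the head cell.
    build : Builds (suc k) x → Star (Step A) (emptyBoard (suc k)) (just x ∷ emptyBoard k)
    build {k} {x} (tile {xs} bs len eq x∈A) with fill-∷ʳ (suc k) xs 1 len
    ... | c , free , place = buildAll bs ◅◅ (c , free , final) ◅ ε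
      where
      length≡ : length (xs ∷ʳ 1) ≡ suc (length xs)
      length≡ = ≡-trans (length-++ xs) (+-comm _ 1)

      sum≡ : sum (xs ∷ʳ 1) ≡ x
      sum≡ = ≡-trans (sum-++ xs (1 ∷ [])) (≡-trans (+-comm (sum xs) 1) (sym eq))

      final : Merge A (fill (suc k) xs [ c ]≔ just 1) (just x ∷ emptyBoard k)
      final = subst (λ P → Merge A P (just x ∷ emptyBoard k)) (sym place)
        (subst (λ y → Merge A (fill (suc k) (xs ∷ʳ 1)) (just y ∷ emptyBoard k)) sum≡
          (merge-fill (xs ∷ʳ 1) (subst (0 <_) (sym length≡) z<s)
            (subst (_≤ suc k) (sym length≡) len) (subst A (sym sum≡) x∈A)))

    buildAll : BuildsAll k xs → Star (Step A) (emptyBoard k) (fill k xs)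
    buildAll []       = ε
    -- The finished tile stays in the head cell, so the rest is played with one cell fewer, matching
    -- the index of `BuildsAll`.
    buildAll (b ∷ bs) = build b ◅◅ play-∷ _ (buildAll bs)

  Builds⇒SingleValue : Builds (suc k) x → SingleValue (suc k) A x
  Builds⇒SingleValue b = Builds⇒A b , zero , _ , build b , refl

  -- A one-tile position has only one order of its tiles, and the first tile in an order has all the
  -- cells at its disposal.
  SingleValue⇒Builds : (∀ {x} → A x → 0 < x) → A 1 → SingleValue (suc k) A x → Builds (suc k) x
  SingleValue⇒Builds {k} {x} pos A1 (_ , c , reach) with Reachable⇒Constructible pos A1 reach
  ... | ts , p , bs with ↭-singleton-inv (↭-trans p tiles≡)
    where
    tiles≡ : tiles (emptyBoard (suc k) [ c ]≔ just x) ↭ x ∷ []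
    tiles≡ = ↭-trans (tiles-place (emptyBoard (suc k)) {c} (lookup-replicate c nothing))
                     (prep x (↭-reflexive (tiles-emptyBoard (suc k))))
  SingleValue⇒Builds _ _ _ | _ , _ , b ∷ [] | refl = b

  -- The last tile of size at least a is made in the fewest cells.
  BuildsAll-count≥ : ∀ a i → BuildsAll k ts → 0 < count≥ a ts → k < count≥ a ts + i →
                     ∃ λ t → a ≤ t × Builds i t
  BuildsAll-count≥ {ts = t ∷ ts} a i (b ∷ bs) 0<c k<c+i with a ≤? t
  ... | no  a≰t = BuildsAll-count≥ a i bs (subst (0 <_) eq 0<c)
                    (<⇒≤ (subst (λ c → _ < c + i) eq k<c+i))
    where eq = cong length (filter-reject (a ≤?_) {xs = ts} a≰t)
  ... | yes a≤t
    with count≥ a ts in eq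
       | subst (λ c → _ < c + i) (cong length (filter-accept (a ≤?_) {xs = ts} a≤t)) k<c+i
  -- No later tile is large, so `t` is the last one; with count 1 the bound says that it was made on
  -- at most `i` cells.
  ... | zero  | k<1+i = t , a≤t , Builds-mono (s≤s⁻¹ k<1+i) b
  ... | suc _ | k<c+i = BuildsAll-count≥ a i bs (subst (0 <_) (sym eq) z<s)
                      (subst (λ c → _ < c + i) (sym eq) (s≤s⁻¹ k<c+i))

  play-cell : x ≡ 0 ⊎ Builds (suc k) x →
              Star (Step A) (emptyBoard (suc k)) (cell x ∷ emptyBoard k)
  play-cell (inj₁ refl)                 = ε
  -- Matching on `refl` exposes `x` as a successor, so `cell x` computes to a tile.
  play-cell (inj₂ b@(tile _ _ refl _)) = build b

  -- The last entry, which is allotted all the cells, is made first and in the head cell, and the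
  -- others follow on the tail. The board therefore lists `v` backwards.
  build-sorted : ∀ n (v : Vec ℕ n) →
                 (∀ i → lookup v i ≡ 0 ⊎ Builds (suc (toℕ i)) (lookup v i)) →
                 ∃ λ Q → Star (Step A) (emptyBoard n) Q × toList Q ↭ List.map cell (toList v)
  build-sorted zero    []  h = [] , ε , refl
  build-sorted (suc n) v h with initLast v
  ... | w , x , refl with build-sorted n w (λ i →
      subst₂ (λ m y → y ≡ 0 ⊎ Builds (suc m) y) (toℕ-inject₁ i) (lookup-∷ʳ-inject₁ w x i) (h (inject₁ i)))
  ... | Q , play , Q↭w = cell x ∷ Q , play-cell last ◅◅ play-∷ (cell x) play , (begin
      cell x ∷ toList Q                    ↭⟨ prep (cell x) Q↭w ⟩
      List.map cell (x ∷ toList w)         ↭⟨ map⁺ cell (∷↭∷ʳ x (toList w)) ⟩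
      List.map cell (toList w ∷ʳ x)        ≡⟨ cong (List.map cell) (toList-∷ʳ x w) ⟨
      List.map cell (toList (w Vec.∷ʳ x))  ∎)
    where
    open PermutationReasoning
    last : x ≡ 0 ⊎ Builds (suc n) x
    last = subst₂ (λ m y → y ≡ 0 ⊎ Builds (suc m) y) (toℕ-fromℕ n) (lookup-∷ʳ-fromℕ w x) (h (fromℕ n))

-- Sorted values compared with the suprema

mainTheorem6 : (A : Pred ℕ 0ℓ) → (∀ {x} → A x → 0 < x) → A 1 →
    (n : ℕ) → 1 ≤ n →
    (single : ℕ → ℕ ⁺) → (∀ i → 1 ≤ i → i ≤ n → IsSingle i A (single i)) →
    (P : Board n) → IsPosition A P →
    (v : Vec ℕ n) → IsSortedValues P v →
    Reachable A P ⇔ (∀ i → [ lookup v i ] ≤⁺ single (suc (toℕ i)))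
mainTheorem6 A pos A1 n _ single isSingle P P∈A v vals = mk⇔ to from
  where
  open IsSortedValues vals

  module Single (i : Fin n) = IsSupremum (isSingle (suc (toℕ i)) z<s (toℕ<n i))

  to : Reachable A P → ∀ i → [ lookup v i ] ≤⁺ single (suc (toℕ i))
  to reach i with lookup v i in eq
  -- The value 0 meets any bound; a positive value serves as the positive threshold that counting
  -- tiles requires.
  ... | zero  = 0≤⁺ _
  ... | suc a with Reachable⇒Constructible A pos A1 reach
  ... | ts , p , bs = large-tile (BuildsAll-count≥ A (suc a) (suc (toℕ i)) bs 0<c n<c+i)
    where
    count≡ : count≥ (suc a) ts ≡ count≥ (suc a) (toList v)
    count≡ = begin
      count≥ (suc a) ts                          ≡⟨ count≥-↭ (suc a) p ⟩
      count≥ (suc a) (tiles P)                   ≡⟨ count≥-tiles a P ⟨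
      count≥ (suc a) (toList (Vec.map value P))  ≡⟨ count≥-↭ (suc a) rearrange ⟨
      count≥ (suc a) (toList v)                  ∎
      where open ≡-Reasoning

    n≤c+i : n ≤ count≥ (suc a) ts + toℕ i
    n≤c+i = subst (λ c → n ≤ c + toℕ i) (sym count≡)
      (subst (λ b → n ≤ count≥ b (toList v) + toℕ i) eq
        (count≥-sorted v (Sorted⇒AllPairs ≤-totalOrder sorted) i))

    -- Positions count from 0 but numbers of cells from 1; this shift makes the inequality strict.
    n<c+i : n < count≥ (suc a) ts + suc (toℕ i)
    n<c+i = ≤-trans (s≤s n≤c+i) (≤-reflexive (sym (+-suc _ (toℕ i))))

    0<c : 0 < count≥ (suc a) ts
    0<c = +-cancelʳ-< (toℕ i) 0 _ (≤-trans (toℕ<n i) n≤c+i)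

    large-tile : (∃ λ t → suc a ≤ t × Builds A (suc (toℕ i)) t) →
                 [ suc a ] ≤⁺ single (suc (toℕ i))
    -- The tile found may exceed `lookup v i`, but the supremum bounds it and hence the smaller
    -- value too.
    large-tile (t , a<t , b) =
      ≤⁺-trans ≤-trans [ a<t ] (Single.upper i (Builds⇒SingleValue A b))

  from : (∀ i → [ lookup v i ] ≤⁺ single (suc (toℕ i))) → Reachable A P
  from v≤single with build-sorted A n v buildable
    where
    v∈A : ∀ i → lookup v i ≡ 0 ⊎ A (lookup v i)
    v∈A i = ListAll.lookup (All-resp-↭ (↭-sym rearrange) (position-values P∈A))
                           (∈-toList⁺ (∈-lookup i v))

    buildable : ∀ i → lookup v i ≡ 0 ⊎ Builds A (suc (toℕ i)) (lookup v i)
    buildable i with lookup v i in eq | v∈A i | v≤single i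
    ... | zero  | _         | _   = inj₁ refl
    -- Approximation at `a` yields a single-tile value of at least `suc a`, whether the supremum is
    -- finite or not; `Builds-down` then lowers it to `suc a`.
    ... | suc a | inj₂ va∈A | a≤s with Single.approx i a (suc≤⁺⇒<⁺ a≤s)
    ... | x , xSingle , a<x =
      inj₂ (Builds-down A (SingleValue⇒Builds A pos A1 xSingle) z<s va∈A a<x)
  ... | Q , play , Q↭v = Q , play , (begin
    toList Q                                      ↭⟨ Q↭v ⟩
    List.map cell (toList v)                      ↭⟨ map⁺ cell rearrange ⟩
    List.map cell (toList (Vec.map value P))      ≡⟨ cell-value pos P∈A ⟩
    toList P                                      ∎)
    where open PermutationReasoning
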